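{- Let $\{p_n(x)\}_{n\ge 0}$ be a sequence of polynomials in $x$ satisfying $$p_{n+2}(x)=a(x)p_{n+1}(x)+b(x)p_n(x),\qquad n\ge 0,$$ with initial polynomials $p_0(x)$ and $p_1(x)$, where $a(x)$ and $b(x)$ are fixed polynomials (independent of $n$). Let $P(t,x)=\sum_{n=0}^{\infty}p_n(x)t^n$. Then $$P(t,x)=\frac{p_0(x)+\bigl(p_1(x)-a(x)p_0(x)\bigr)t}{1-a(x)t-b(x)t^2}.$$ The coefficient matrix of $\{p_n(x)\}$ is an ordinary Riordan array $(g,f)$, i.e. $p_n(x)=\sum_{k=0}^n d_{n,k}x^k$ with $d_{n,k}=[t^n]\,g(t)f(t)^k$, if and only if the following three conditions hold: (1) both $a(x)$ and $b(x)$ are affine functions of $x$: $a(x)=a_0+a_1x$, $b(x)=b_0+b_1x$ with constants $a_0,a_1,b_0,b_1$; (2) $p_0(x)=c$ is a constant; (3) the polynomial $p_1(x)-a(x)p_0(x)$ is independent of $x$. Under these conditions, $$P(t,x)=\frac{g(t)}{1-xf(t)},\qquad g(t)=\frac{c+dt}{1-a_0t-b_0t^2},\qquad f(t)=\frac{a_1t+b_1t^2}{1-a_0t-b_0t^2},$$ where $d=p_1(x)-a(x)p_0(x)$, a constant by (3).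
   Context: All polynomials and formal power series have coefficients in a field $\mathbb K$ of characteristic $0$. A Riordan array $(g,f)$ is given by formal power series $g(t)=\sum_{n\ge 0}g_nt^n$ with $g_0\ne 0$ and $f(t)=\sum_{n\ge 1}f_nt^n$ with $f_1\neq 0$; it is the infinite lower triangular matrix $[d_{n,k}]_{n,k\ge 0}$ with $d_{n,k}=[t^n]\,g(t)f(t)^k$, where $[t^n]$ denotes extraction of the coefficient of $t^n$. The coefficient matrix of a polynomial sequence is the matrix whose $(n,k)$ entry is the coefficient of $x^k$ in $p_n(x)$.
   Formalization: The "if and only if" fails as written: "(1)–(3) imply Riordan" is proved assuming c ≠ 0 and a_1 ≠ 0, and "Riordan implies (1)–(3)" assuming p_0 p_2 ≠ p_1^2 (the sequence is not geometric; p_n=(1+x)^n with a=1, b=x+x^2 is a counterexample). -}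

module Defs where

open import Level using (Level; _⊔_)
open import Data.Nat.Base as ℕ using (ℕ; zero; suc; _∸_)
open import Data.Fin.Base using (toℕ)
open import Data.List.Base using (List; []; _∷_; map)
open import Data.Product.Base using (_×_; ∃-syntax)
open import Relation.Nullary.Negation using (¬_)
open import Relation.Binary.Core using (Rel)
open import Algebra.Bundles using (RawRing)
open import Algebra.Apartness.Bundles using (HeytingField)
import Algebra.Definitions
import Algebra.Definitions.RawSemiring

private
  variable
    c ℓ ℓ₁ ℓ₂ : Level

-- Only the operations of R are needed to write down those of R[x] and R[[t]],
-- so both constructions act on raw rings and can be iterated, as in K[x][[t]].

module Polynomial (R : RawRing c ℓ) where
  open RawRing R

  -- Coefficients are listed from degree 0 upwards. Trailing zeros are allowed:
  -- polynomials are compared coefficientwise.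
  Poly : Set c
  Poly = List Carrier

  coeff : Poly → ℕ → Carrier
  coeff []      _       = 0#
  coeff (r ∷ p) zero    = r
  coeff (r ∷ p) (suc n) = coeff p n

  _≈ₚ_ : Rel Poly ℓ
  p ≈ₚ q = ∀ n → coeff p n ≈ coeff q n

  _+ₚ_ : Poly → Poly → Poly
  []      +ₚ q       = q
  (r ∷ p) +ₚ []      = r ∷ p
  (r ∷ p) +ₚ (s ∷ q) = (r + s) ∷ (p +ₚ q)

  _*ₚ_ : Poly → Poly → Poly
  []      *ₚ q = []
  (r ∷ p) *ₚ q = map (r *_) q +ₚ (0# ∷ (p *ₚ q))

  polynomialRing : RawRing c ℓ
  polynomialRing = record
    { Carrier = Poly
    ; _≈_     = _≈ₚ_
    ; _+_     = _+ₚ_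
    ; _*_     = _*ₚ_
    ; -_      = map (-_)
    ; 0#      = []
    ; 1#      = 1# ∷ []
    }

module PowerSeries (R : RawRing c ℓ) where
  open RawRing R
  open Algebra.Definitions _≈_ using (Invertible)
  open Algebra.Definitions.RawSemiring rawSemiring using (sum)
  open Polynomial R using (coeff)

  -- The series Σₙ sₙ tⁿ is its coefficient sequence, so [tⁿ] s is s n.
  Series : Set c
  Series = ℕ → Carrier

  seriesRing : RawRing c ℓ
  seriesRing = record
    { Carrier = Series
    ; _≈_     = λ s u → ∀ n → s n ≈ u n
    ; _+_     = λ s u n → s n + u n
    ; _*_     = λ s u n → sum {suc n} (λ i → s (toℕ i) * u (n ∸ toℕ i))
    ; -_      = λ s n → - s n
    ; 0#      = λ _ → 0#
    ; 1#      = coeff (1# ∷ [])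
    }

  -- The polynomial r₀ + r₁ t + r₂ t² + ⋯ in t, as a series.
  ⟦_⟧ : List Carrier → Series
  ⟦ rs ⟧ = coeff rs

  -- s = u / v. The constant term of v is required to be a unit, so v is a unit
  -- of R[[t]] (R commutative) and s is the unique series with s v = u.
  infix 4 _≈_/_
  _≈_/_ : Series → Series → Series → Set (c ⊔ ℓ)
  s ≈ u / v = Invertible 1# _*_ (v 0) × (s *ₛ v) ≈ₛ u
    where open RawRing seriesRing using () renaming (_*_ to _*ₛ_; _≈_ to _≈ₛ_)

-- A field is a HeytingField, with "≠ 0" read as "# 0#"; no decidability of
-- equality is assumed. The field axiom 0 ≠ 1 follows from invertible⇒#.

rawRing : HeytingField c ℓ₁ ℓ₂ → RawRing c ℓ₁
rawRing K = record
  { Carrier = Carrier ; _≈_ = _≈_ ; _+_ = _+_ ; _*_ = _*_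
  ; -_ = -_ ; 0# = 0# ; 1# = 1# }
  where open HeytingField K

CharacteristicZero : HeytingField c ℓ₁ ℓ₂ → Set ℓ₁
CharacteristicZero K = ∀ n → ¬ (suc n ⋆ 1# ≈ 0#)
  where
  open HeytingField K
  open Algebra.Definitions.RawSemiring (RawRing.rawSemiring (rawRing K))
    using () renaming (_×_ to _⋆_)

module Riordan (K : HeytingField c ℓ₁ ℓ₂) where
  open HeytingField K public using (Carrier; _#_; 0#; 1#)
    renaming (_≈_ to _≈ₖ_; -_ to -ₖ_)

  open Polynomial (rawRing K) public using (Poly; coeff; polynomialRing)
  open RawRing polynomialRing public using (_≈_; _≉_; _+_; _*_; -_)
    renaming (1# to 1ₚ)

  module K⟦t⟧ where
    open PowerSeries (rawRing K) public
    open RawRing seriesRing public using (_*_)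
    open Algebra.Definitions.RawSemiring (RawRing.rawSemiring seriesRing)
      public using (_^_)

  module K[x]⟦t⟧ where
    open PowerSeries polynomialRing public
    open RawRing seriesRing public using (_+_; -_; 1#)

  Matrix : Set c
  Matrix = ℕ → ℕ → Carrier

  record RiordanArray : Set (c ⊔ ℓ₁ ⊔ ℓ₂) where
    field
      g    : K⟦t⟧.Series
      f    : K⟦t⟧.Series
      g₀≠0 : g 0 # 0#
      f₀≈0 : f 0 ≈ₖ 0#
      f₁≠0 : f 1 # 0#

    matrix : Matrix
    matrix n k = (g K⟦t⟧.* (f K⟦t⟧.^ k)) n

  IsRiordan : Matrix → Set (c ⊔ ℓ₁ ⊔ ℓ₂)
  IsRiordan M = ∃[ A ] (∀ n k → M n k ≈ₖ RiordanArray.matrix A n k)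

  coefficientMatrix : (ℕ → Poly) → Matrix
  coefficientMatrix p n k = coeff (p n) k

  generatingFunction : (ℕ → Poly) → K[x]⟦t⟧.Series
  generatingFunction p = p

  -- g(t), and x f(t), as elements of K[x][[t]].
  embed : K⟦t⟧.Series → K[x]⟦t⟧.Series
  embed g n = g n ∷ []

  x·_ : K⟦t⟧.Series → K[x]⟦t⟧.Series
  (x· f) n = 0# ∷ f n ∷ []

  SatisfiesRecurrence : Poly → Poly → (ℕ → Poly) → Set ℓ₁
  SatisfiesRecurrence a b p = ∀ n → p (2 ℕ.+ n) ≈ a * p (1 ℕ.+ n) + b * p n

  record Conditions (a b p₀ p₁ : Poly) (a₀ a₁ b₀ b₁ c₀ d : Carrier) : Set ℓ₁ where
    field
      a-affine    : a ≈ a₀ ∷ a₁ ∷ []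
      b-affine    : b ≈ b₀ ∷ b₁ ∷ []
      p₀-constant : p₀ ≈ c₀ ∷ []
      d-constant  : p₁ + - (a * p₀) ≈ d ∷ []

{-# OPTIONS --safe #-}

-- The matrix of p is the Riordan array (g, f) iff P (1 - x f) = g, that is, iff
-- column 0 of P is g and column k + 1 is f times column k. If (1)-(3) hold,
-- reading the recurrence column by column gives these relations.
-- Conversely, comparing P (1 - x f) = g with P (1 - a t - b t²) = p₀ + q t, where
-- q = p₁ - a p₀, gives g (1 - a t - b t²) = (p₀ + q t) (1 - x f). A nonzero
-- leading coefficient of q in positive degree would force f to be a multiple of
-- t g and g to be a constant over a polynomial of degree ≤ 1, hence p₀ p₂ = p₁².
-- So the coefficients of q in positive degree vanish from the top down (each is
-- zero by tightness of the apartness), and then so do those of a and b in degree ≥ 2.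

module Submission where

open import Defs
open import Level using (Level)
open import Data.Nat.Base as ℕ using (ℕ; zero; suc)
open import Data.List.Base using ([]; _∷_; map)
open import Data.Product.Base using (_×_; ∃-syntax; _,_; proj₁)
open import Function.Base using (_∘_)
open import Relation.Nullary.Negation using (¬_)
open import Algebra.Bundles using (RawRing; CommutativeRing)
open import Algebra.Definitions using (Invertible)
open import Algebra.Structures using (IsCommutativeRing)
open import Algebra.Morphism.Structures using (IsRingMonomorphism)
import Algebra.Construct.Pointwise as Pointwise
import Algebra.Structures
import Algebra.Definitions.RawSemiring
import Algebra.Morphism.RingMonomorphism as RingMonomorphism
import Algebra.Properties.AbelianGroup
import Algebra.Properties.CommutativeSemigroup
import Algebra.Properties.Ring
import Algebra.Solver.Ring.NaturalCoefficients.Default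
import Algebra.Consequences.Setoid
import Relation.Binary.Reasoning.Setoid
open import Algebra.Apartness.Bundles using (HeytingField; HeytingCommutativeRing)
import Algebra.Apartness.Properties.HeytingCommutativeRing

private
  variable
    c ℓ ℓ₁ ℓ₂ : Level

invertible-1 : (R : CommutativeRing c ℓ) → let open CommutativeRing R in
               Invertible _≈_ 1# _*_ 1#
invertible-1 R = 1# , *-identityˡ 1# , *-identityˡ 1#
  where open CommutativeRing R

-- Formal power series over a commutative ring.

module SeriesProperties (R : CommutativeRing c ℓ) where
  open CommutativeRing R hiding (rawRing)
  open PowerSeries (CommutativeRing.rawRing R) using (Series; seriesRing; ⟦_⟧)
  open RawRing seriesRing
    using () renaming (_≈_ to _≈ₛ_; _*_ to _*ₛ_; _+_ to _+ₛ_; 1# to 1ₛ; 0# to 0ₛ)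
  open Algebra.Properties.Ring ring
    using (-‿distribˡ-*) renaming (x≈y⇒x∙y⁻¹≈ε to x≈y⇒x-y≈0)
  open Algebra.Properties.AbelianGroup +-abelianGroup using (⁻¹-∙-comm)
  open Algebra.Properties.CommutativeSemigroup +-commutativeSemigroup
    using (interchange; x∙yz≈y∙xz)
  open Algebra.Solver.Ring.NaturalCoefficients.Default commutativeSemiring
    using (solve; _:=_; _:+_; _:*_; con)
  open Relation.Binary.Reasoning.Setoid setoid

  -- By definition (s *ₛ u) (suc n) = s 0 * u (suc n) + (tail s *ₛ u) n, which
  -- makes the ring laws inductions on n.
  tail : Series → Series
  tail s n = s (suc n)

  *ₛ-cong : ∀ {s s′ u u′} → s ≈ₛ s′ → u ≈ₛ u′ → s *ₛ u ≈ₛ s′ *ₛ u′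
  *ₛ-cong s≈ u≈ zero    = +-congʳ (*-cong (s≈ 0) (u≈ 0))
  *ₛ-cong s≈ u≈ (suc n) =
    +-cong (*-cong (s≈ 0) (u≈ (suc n))) (*ₛ-cong (s≈ ∘ suc) u≈ n)

  *ₛ-zeroˡ : ∀ u → 0ₛ *ₛ u ≈ₛ 0ₛ
  *ₛ-zeroˡ u zero    = trans (+-identityʳ _) (zeroˡ _)
  *ₛ-zeroˡ u (suc n) =
    trans (+-cong (zeroˡ _) (*ₛ-zeroˡ u n)) (+-identityˡ _)

  *ₛ-head : ∀ s u → (s *ₛ u) 0 ≈ s 0 * u 0
  *ₛ-head s u = +-identityʳ _

  *ₛ-constant : ∀ s u → tail s ≈ₛ 0ₛ → ∀ n → (s *ₛ u) n ≈ s 0 * u n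
  *ₛ-constant s u ts≈0 zero    = +-identityʳ _
  *ₛ-constant s u ts≈0 (suc n) =
    trans (+-congˡ (trans (*ₛ-cong {u = u} ts≈0 (λ _ → refl) n) (*ₛ-zeroˡ u n)))
          (+-identityʳ _)

  *ₛ-linear : ∀ r s u n →
              (⟦ r ∷ s ∷ [] ⟧ *ₛ u) (suc n) ≈ r * u (suc n) + s * u n
  *ₛ-linear r s u n = +-congˡ (*ₛ-constant ⟦ s ∷ [] ⟧ u (λ _ → refl) n)

  *ₛ-identityˡ : ∀ u → 1ₛ *ₛ u ≈ₛ u
  *ₛ-identityˡ u n = trans (*ₛ-constant 1ₛ u (λ _ → refl) n) (*-identityˡ _)

  *ₛ-distribʳ : ∀ u s s′ → (s +ₛ s′) *ₛ u ≈ₛ s *ₛ u +ₛ s′ *ₛ u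
  *ₛ-distribʳ u s s′ zero =
    solve 3 (λ s s′ u → (s :+ s′) :* u :+ con 0
                        := (s :* u :+ con 0) :+ (s′ :* u :+ con 0))
      refl (s 0) (s′ 0) (u 0)
  *ₛ-distribʳ u s s′ (suc n) = trans
    (+-cong (distribʳ _ _ _) (*ₛ-distribʳ u (tail s) (tail s′) n))
    (interchange _ _ _ _)

  *ₛ-scale : ∀ r s u n → ((λ i → r * s i) *ₛ u) n ≈ r * (s *ₛ u) n
  *ₛ-scale r s u zero    =
    solve 3 (λ r s u → r :* s :* u :+ con 0 := r :* (s :* u :+ con 0))
      refl r (s 0) (u 0)
  *ₛ-scale r s u (suc n) =
    trans (+-cong (*-assoc _ _ _) (*ₛ-scale r (tail s) u n))
          (sym (distribˡ _ _ _))

  -- The convolution sum unfolds by definition at its first term. Splitting it at the last term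
  -- instead is what the induction for commutativity needs.
  *ₛ-last : ∀ s u n → (s *ₛ u) (suc n) ≈ s (suc n) * u 0 + (s *ₛ tail u) n
  *ₛ-last s u zero    = x∙yz≈y∙xz _ _ _
  *ₛ-last s u (suc n) =
    trans (+-congˡ (*ₛ-last (tail s) u n)) (x∙yz≈y∙xz _ _ _)

  *ₛ-comm : ∀ s u → s *ₛ u ≈ₛ u *ₛ s
  *ₛ-comm s u zero    = +-congʳ (*-comm _ _)
  *ₛ-comm s u (suc n) =
    trans (+-cong (*-comm _ _) (*ₛ-comm (tail s) u n)) (sym (*ₛ-last u s n))

  *ₛ-assoc : ∀ s u v → (s *ₛ u) *ₛ v ≈ₛ s *ₛ (u *ₛ v)
  *ₛ-assoc s u v zero    =
    solve 3 (λ s u v → (s :* u :+ con 0) :* v :+ con 0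
                       := s :* (u :* v :+ con 0) :+ con 0)
      refl (s 0) (u 0) (v 0)
  *ₛ-assoc s u v (suc n) = begin
    (s *ₛ u) 0 * v (suc n) + (tail (s *ₛ u) *ₛ v) n
      -- The tail of s u is by definition s₀ times the tail of u, plus the tail of s times u, so
      -- distributivity splits its product with v.
      ≈⟨ +-congˡ (*ₛ-distribʳ v (λ i → s 0 * tail u i) (tail s *ₛ u) n) ⟩
    (s *ₛ u) 0 * v (suc n)
      + (((λ i → s 0 * tail u i) *ₛ v) n + ((tail s *ₛ u) *ₛ v) n)
      ≈⟨ +-cong (*-congʳ (*ₛ-head s u))
           (+-cong (*ₛ-scale (s 0) (tail u) v n) (*ₛ-assoc (tail s) u v n)) ⟩
    s 0 * u 0 * v (suc n) + (s 0 * (tail u *ₛ v) n + (tail s *ₛ (u *ₛ v)) n)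
      ≈⟨ solve 5 (λ s u v w x → s :* u :* v :+ (s :* w :+ x)
                                := s :* (u :* v :+ w) :+ x) refl _ _ _ _ _ ⟩
    (s *ₛ (u *ₛ v)) (suc n) ∎

  series-isCommutativeRing : IsCommutativeRing _≈ₛ_ _+ₛ_ _*ₛ_ (λ s n → - s n) 0ₛ 1ₛ
  series-isCommutativeRing = record
    { isRing = record
      { +-isAbelianGroup = +-isAbelianGroupₛ
      ; *-cong           = *ₛ-cong
      ; *-assoc          = *ₛ-assoc
      ; *-identity       = comm∧idˡ⇒id *ₛ-comm *ₛ-identityˡ
      ; distrib          = comm∧distrʳ⇒distr +-congₛ *ₛ-comm *ₛ-distribʳ
      }
    ; *-comm = *ₛ-comm
    }
    where
    +-isAbelianGroupₛ = Pointwise.isAbelianGroup ℕ +-isAbelianGroup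
    open Algebra.Structures.IsAbelianGroup +-isAbelianGroupₛ
      using () renaming (setoid to setoidₛ; ∙-cong to +-congₛ)
    open Algebra.Consequences.Setoid setoidₛ
      using (comm∧idˡ⇒id; comm∧distrʳ⇒distr)

  seriesCommutativeRing : CommutativeRing c ℓ
  seriesCommutativeRing = record { isCommutativeRing = series-isCommutativeRing }

  -- The reciprocal of 1 - α t - β t².
  recip : Carrier → Carrier → Series
  recip α β zero          = 1#
  recip α β (suc zero)    = α
  recip α β (suc (suc n)) = α * recip α β (suc n) + β * recip α β n

  -- Division by a quadratic polynomial with constant term 1.

  module _ (α β : Carrier) where
    denominator : Series
    denominator = ⟦ 1# ∷ - α ∷ - β ∷ [] ⟧

    *ₛ-denominator₀ : ∀ s → (s *ₛ denominator) 0 ≈ s 0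
    *ₛ-denominator₀ s = trans (*ₛ-head s denominator) (*-identityʳ _)

    *ₛ-denominator₁ : ∀ s → (s *ₛ denominator) 1 ≈ s 1 - α * s 0
    *ₛ-denominator₁ s = begin
      (s *ₛ denominator) 1
        ≈⟨ *ₛ-comm s denominator 1 ⟩
      1# * s 1 + (- α * s 0 + 0#)
        ≈⟨ +-cong (*-identityˡ _)
             (trans (+-identityʳ _) (sym (-‿distribˡ-* α (s 0)))) ⟩
      s 1 - α * s 0 ∎

    *ₛ-denominator₂ : ∀ s n →
      (s *ₛ denominator) (2 ℕ.+ n) ≈ s (2 ℕ.+ n) - (α * s (1 ℕ.+ n) + β * s n)
    *ₛ-denominator₂ s n = begin
      (s *ₛ denominator) (2 ℕ.+ n)
        ≈⟨ *ₛ-comm s denominator (2 ℕ.+ n) ⟩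
      1# * s (2 ℕ.+ n) + (⟦ - α ∷ - β ∷ [] ⟧ *ₛ s) (1 ℕ.+ n)
        ≈⟨ +-cong (*-identityˡ _) (*ₛ-linear (- α) (- β) s n) ⟩
      s (2 ℕ.+ n) + (- α * s (1 ℕ.+ n) + - β * s n)
        ≈⟨ +-congˡ (+-cong (-‿distribˡ-* α _) (-‿distribˡ-* β _)) ⟨
      s (2 ℕ.+ n) + (- (α * s (1 ℕ.+ n)) + - (β * s n))
        ≈⟨ +-congˡ (⁻¹-∙-comm _ _) ⟩
      s (2 ℕ.+ n) - (α * s (1 ℕ.+ n) + β * s n) ∎

    -- From degree 2 on, the coefficients of the product are the defects of the recurrence, so only
    -- the two initial terms survive. This serves over K for `recip` and over K[x] for the sequence
    -- itself.
    recurrence⇒numerator : ∀ s →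
      (∀ n → s (2 ℕ.+ n) ≈ α * s (1 ℕ.+ n) + β * s n) →
      s *ₛ denominator ≈ₛ ⟦ s 0 ∷ s 1 - α * s 0 ∷ [] ⟧
    recurrence⇒numerator s rec zero          = *ₛ-denominator₀ s
    recurrence⇒numerator s rec (suc zero)    = *ₛ-denominator₁ s
    recurrence⇒numerator s rec (suc (suc n)) =
      trans (*ₛ-denominator₂ s n) (x≈y⇒x-y≈0 (rec n))

    recip-inverse : recip α β *ₛ denominator ≈ₛ 1ₛ
    recip-inverse n = trans
      (recurrence⇒numerator (recip α β) (λ _ → refl) n) (numerator n)
      where
      numerator : ⟦ 1# ∷ α - α * 1# ∷ [] ⟧ ≈ₛ 1ₛ
      numerator zero          = refl
      numerator (suc zero)    = x≈y⇒x-y≈0 (sym (*-identityʳ α))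
      numerator (suc (suc n)) = refl

    -- Uniqueness of the quotient: multiply s by the denominator and its inverse, then regroup.
    *ₛ-recip : ∀ s u → s *ₛ denominator ≈ₛ u → s ≈ₛ u *ₛ recip α β
    *ₛ-recip s u sv≈u n = begin
      s n
        ≈⟨ *ₛ-identityˡ s n ⟨
      (1ₛ *ₛ s) n
        ≈⟨ *ₛ-comm 1ₛ s n ⟩
      (s *ₛ 1ₛ) n
        ≈⟨ *ₛ-cong {s} (λ _ → refl) v⁻¹ n ⟨
      (s *ₛ (denominator *ₛ recip α β)) n
        ≈⟨ *ₛ-assoc s denominator (recip α β) n ⟨
      ((s *ₛ denominator) *ₛ recip α β) n
        ≈⟨ *ₛ-cong {u = recip α β} sv≈u (λ _ → refl) n ⟩
      (u *ₛ recip α β) n ∎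
      where
      v⁻¹ : denominator *ₛ recip α β ≈ₛ 1ₛ
      v⁻¹ i = trans (*ₛ-comm denominator (recip α β) i) (recip-inverse i)

    recip-quotient : ∀ u → (u *ₛ recip α β) *ₛ denominator ≈ₛ u
    recip-quotient u n = begin
      ((u *ₛ recip α β) *ₛ denominator) n
        ≈⟨ *ₛ-assoc u (recip α β) denominator n ⟩
      (u *ₛ (recip α β *ₛ denominator)) n
        ≈⟨ *ₛ-cong {u} (λ _ → refl) recip-inverse n ⟩
      (u *ₛ 1ₛ) n
        ≈⟨ *ₛ-comm u 1ₛ n ⟩
      (1ₛ *ₛ u) n
        ≈⟨ *ₛ-identityˡ u n ⟩
      u n ∎

-- Polynomials as a subring of the power series.

module PolynomialProperties (R : CommutativeRing c ℓ) where
  open CommutativeRing R hiding (rawRing)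
  open Polynomial (CommutativeRing.rawRing R)
  open PowerSeries (CommutativeRing.rawRing R) using (seriesRing)
  open RawRing seriesRing using () renaming (_≈_ to _≈ₛ_; _*_ to _*ₛ_)
  open Algebra.Properties.Ring ring using (-0#≈0#)
  module Series = SeriesProperties R

  coeff-+ : ∀ p q n → coeff (p +ₚ q) n ≈ coeff p n + coeff q n
  coeff-+ []      q       n       = sym (+-identityˡ _)
  coeff-+ (r ∷ p) []      n       = sym (+-identityʳ _)
  coeff-+ (r ∷ p) (s ∷ q) zero    = refl
  coeff-+ (r ∷ p) (s ∷ q) (suc n) = coeff-+ p q n

  coeff-neg : ∀ p n → coeff (map -_ p) n ≈ - coeff p n
  coeff-neg []      n       = sym -0#≈0#
  coeff-neg (r ∷ p) zero    = refl
  coeff-neg (r ∷ p) (suc n) = coeff-neg p n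

  coeff-scale : ∀ r p n → coeff (map (r *_) p) n ≈ r * coeff p n
  coeff-scale r []      n       = sym (zeroʳ r)
  coeff-scale r (s ∷ p) zero    = refl
  coeff-scale r (s ∷ p) (suc n) = coeff-scale r p n

  coeff-* : ∀ p q → coeff (p *ₚ q) ≈ₛ coeff p *ₛ coeff q
  coeff-* []      q n       = sym (Series.*ₛ-zeroˡ (coeff q) n)
  coeff-* (r ∷ p) q zero    =
    trans (coeff-+ (map (r *_) q) _ 0) (+-congʳ (coeff-scale r q 0))
  coeff-* (r ∷ p) q (suc n) =
    trans (coeff-+ (map (r *_) q) _ (suc n))
          (+-cong (coeff-scale r q (suc n)) (coeff-* p q n))

  -- Equality of polynomials is equality of their coefficient sequences, so injectivity is immediate
  -- and the ring laws of R[x] are pulled back from those of series.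
  coeff-isRingMonomorphism : IsRingMonomorphism polynomialRing seriesRing coeff
  coeff-isRingMonomorphism = record
    { isRingHomomorphism = record
      { isSemiringHomomorphism = record
        { isNearSemiringHomomorphism = record
          { +-isMonoidHomomorphism = record
            { isMagmaHomomorphism = record
              { isRelHomomorphism = record { cong = λ p≈q → p≈q }
              ; homo              = coeff-+
              }
            ; ε-homo = λ _ → refl
            }
          ; *-homo = coeff-*
          }
        ; 1#-homo = λ _ → refl
        }
      ; -‿homo = coeff-neg
      }
    ; injective = λ p≈q → p≈q
    }

  polynomialCommutativeRing : CommutativeRing c ℓ
  polynomialCommutativeRing = record
    { isCommutativeRing =
        RingMonomorphism.isCommutativeRing coeff-isRingMonomorphism
          Series.series-isCommutativeRing
    }

  *-affine₀ : ∀ {r₀ r₁} p q → p ≈ₚ (r₀ ∷ r₁ ∷ []) →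
              coeff (p *ₚ q) 0 ≈ r₀ * coeff q 0
  *-affine₀ p q p≈ = trans (coeff-* p q 0)
    (trans (+-identityʳ _) (*-congʳ (p≈ 0)))

  *-affine₁ : ∀ {r₀ r₁} p q k → p ≈ₚ (r₀ ∷ r₁ ∷ []) →
    coeff (p *ₚ q) (suc k) ≈ r₀ * coeff q (suc k) + r₁ * coeff q k
  *-affine₁ {r₀} {r₁} p q k p≈ = trans (coeff-* p q (suc k))
    (trans (Series.*ₛ-cong {u = coeff q} p≈ (λ _ → refl) (suc k))
           (Series.*ₛ-linear r₀ r₁ (coeff q) k))

  *-constantʳ : ∀ {r} p q → q ≈ₚ (r ∷ []) →
                ∀ n → coeff (p *ₚ q) n ≈ coeff p n * r
  *-constantʳ {r} p q q≈ n = trans (coeff-* p q n)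
    (trans (Series.*ₛ-comm (coeff p) (coeff q) n)
    (trans (Series.*ₛ-constant (coeff q) (coeff p) (q≈ ∘ suc) n)
    (trans (*-congʳ (q≈ 0)) (*-comm r _))))

  -- A list ends, so its coefficients are zero from some degree on, and `step` carries this down to
  -- degree m. Induction on the list replaces a search for the leading coefficient, which would need
  -- decidable equality.
  vanish-downwards : ∀ p m →
    (∀ n → coeff p (suc (m ℕ.+ n)) ≈ 0# → coeff p (m ℕ.+ n) ≈ 0#) →
    ∀ n → coeff p (m ℕ.+ n) ≈ 0#
  vanish-downwards []      m       step n       = refl
  vanish-downwards (r ∷ p) (suc m) step n       = vanish-downwards p m step n
  vanish-downwards (r ∷ p) zero    step zero    =
    step 0 (vanish-downwards p 0 (step ∘ suc) 0)
  vanish-downwards (r ∷ p) zero    step (suc n) =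
    vanish-downwards p 0 (step ∘ suc) n

-- Series and polynomials over a Heyting field.

module RiordanProperties (K : HeytingField c ℓ₁ ℓ₂) where
  open HeytingField K using (_#_; tight; #⇒invertible; heytingCommutativeRing)
  open Algebra.Apartness.Properties.HeytingCommutativeRing heytingCommutativeRing
    using (x-0≈x; #-congʳ)

  𝕂 : CommutativeRing _ _
  𝕂 = HeytingCommutativeRing.commutativeRing heytingCommutativeRing

  open CommutativeRing 𝕂 hiding (rawRing)
  open Polynomial (CommutativeRing.rawRing 𝕂)
  open PolynomialProperties 𝕂
  open SeriesProperties 𝕂

  𝕂[x] : CommutativeRing _ _
  𝕂[x] = polynomialCommutativeRing

  open PowerSeries (CommutativeRing.rawRing 𝕂) using (Series; seriesRing; ⟦_⟧)
  open RawRing seriesRing using () renaming (_≈_ to _≈ₛ_; _*_ to _*ₛ_)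
  open Algebra.Definitions.RawSemiring (RawRing.rawSemiring seriesRing)
    using () renaming (_^_ to _^ₛ_)

  module 𝕂[x]⟦t⟧ = PowerSeries polynomialRing
  open RawRing 𝕂[x]⟦t⟧.seriesRing using () renaming
    (_≈_ to _≈ₜ_; _+_ to _+ₜ_; _*_ to _*ₜ_; -_ to -ₜ_; 1# to 1ₜ; Carrier to Seriesₜ)
  -- The series development is used a second time, with coefficients in `𝕂[x]`, to compute in
  -- K[x][[t]].
  module T = CommutativeRing (SeriesProperties.seriesCommutativeRing 𝕂[x])
  module TP = SeriesProperties 𝕂[x]

  open Algebra.Properties.CommutativeSemigroup
    (CommutativeRing.*-commutativeSemigroup seriesCommutativeRing)
    using () renaming (x∙yz≈y∙xz to x*yz≈y*xz; xy∙z≈xz∙y to xy*z≈xz*y)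

  open Riordan K using (embed; x·_; RiordanArray; IsRiordan; Conditions)

  open Algebra.Properties.Ring ring
    using (-0#≈0#) renaming
      (x≈y⇒x∙y⁻¹≈ε to x≈y⇒x-y≈0; x∙y⁻¹≈ε⇒x≈y to x-y≈0⇒x≈y)
  open Algebra.Properties.AbelianGroup +-abelianGroup using (xyx⁻¹≈y)
    renaming (⁻¹-injective to -‿injective; ∙-cancelˡ to +-cancelˡ; ∙-cancelʳ to +-cancelʳ)
  open Algebra.Properties.CommutativeSemigroup +-commutativeSemigroup
    using (interchange)
  open Algebra.Properties.CommutativeSemigroup *-commutativeSemigroup
    using (x∙yz≈y∙xz; xy∙z≈xz∙y)
  open Algebra.Solver.Ring.NaturalCoefficients.Default commutativeSemiring
    using (solve; _:=_; _:+_; _:*_; con)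
  open Relation.Binary.Reasoning.Setoid setoid

  #0-cancelˡ : ∀ {x} y z → x # 0# → x * y ≈ x * z → y ≈ z
  #0-cancelˡ {x} y z x#0 xy≈xz with #⇒invertible x#0
  ... | x⁻¹ , x⁻¹x≈1 , _ = trans (sym (cancel y)) (trans (*-congˡ xy≈xz) (cancel z))
    where
    cancel : ∀ w → x⁻¹ * (x * w) ≈ w
    cancel w = begin
      x⁻¹ * (x * w)        ≈⟨ *-assoc x⁻¹ x w ⟨
      -- The inverse supplied by x # 0 is that of x - 0, so the zero has to be inserted first.
      x⁻¹ * x * w          ≈⟨ *-congʳ (*-congˡ (x-0≈x x)) ⟨
      x⁻¹ * (x - 0#) * w   ≈⟨ *-congʳ x⁻¹x≈1 ⟩
      1# * w               ≈⟨ *-identityˡ w ⟩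
      w                    ∎

  #0-cancelˡ-0 : ∀ {x} y → x # 0# → x * y ≈ 0# → y ≈ 0#
  #0-cancelˡ-0 y x#0 xy≈0 = #0-cancelˡ y 0# x#0 (trans xy≈0 (sym (zeroʳ _)))

  -- Columns of a generating function and the fraction g / (1 - x f).

  column : Seriesₜ → ℕ → Series
  column P k n = coeff (P n) k

  -- The columns are the coefficients of powers of x in P = g / (1 - x f).
  record HasColumns (g f : Series) (P : Seriesₜ) : Set ℓ₁ where
    constructor _,_
    field
      column₀ : column P 0 ≈ₛ g
      column₁ : ∀ k → column P (suc k) ≈ₛ f *ₛ column P k

  x·-column₀ : ∀ f P n → coeff (((x· f) *ₜ P) n) 0 ≈ 0#
  x·-column₀ f P n = lemma f n
    where
    head≈0 : ∀ r q → coeff ((0# ∷ r ∷ []) *ₚ q) 0 ≈ 0#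
    head≈0 r q = trans (*-affine₀ (0# ∷ r ∷ []) q (λ _ → refl)) (zeroˡ _)
    -- The tail of `x· f` is `x· (tail f)`, so the induction on n changes f and keeps P fixed.
    lemma : ∀ f n → coeff (((x· f) *ₜ P) n) 0 ≈ 0#
    lemma f zero    = trans (coeff-+ ((0# ∷ f 0 ∷ []) *ₚ P 0) [] 0)
      (trans (+-identityʳ _) (head≈0 (f 0) (P 0)))
    lemma f (suc n) = trans (coeff-+ ((0# ∷ f 0 ∷ []) *ₚ P (suc n)) _ 0)
      (trans (+-cong (head≈0 (f 0) (P (suc n))) (lemma (tail f) n)) (+-identityˡ _))

  x·-column₁ : ∀ f P n k → coeff (((x· f) *ₜ P) n) (suc k) ≈ (f *ₛ column P k) n
  x·-column₁ f P n k = lemma f n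
    where
    shift : ∀ r q → coeff ((0# ∷ r ∷ []) *ₚ q) (suc k) ≈ r * coeff q k
    shift r q = trans (*-affine₁ (0# ∷ r ∷ []) q k (λ _ → refl))
      (trans (+-congʳ (zeroˡ _)) (+-identityˡ _))
    lemma : ∀ f n → coeff (((x· f) *ₜ P) n) (suc k) ≈ (f *ₛ column P k) n
    lemma f zero    = trans (coeff-+ ((0# ∷ f 0 ∷ []) *ₚ P 0) [] (suc k))
      (+-congʳ (shift (f 0) (P 0)))
    lemma f (suc n) = trans (coeff-+ ((0# ∷ f 0 ∷ []) *ₚ P (suc n)) _ (suc k))
      (+-cong (shift (f 0) (P (suc n))) (lemma (tail f) n))

  1-x· : Series → Seriesₜ
  1-x· f = 1ₜ +ₜ (-ₜ (x· f))

  *-1-x· : ∀ f P n k → coeff ((P *ₜ 1-x· f) n) k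
           ≈ coeff (P n) k - coeff (((x· f) *ₜ P) n) k
  *-1-x· f P n k = begin
    coeff ((P *ₜ 1-x· f) n) k
      ≈⟨ T.*-comm P (1-x· f) n k ⟩
    coeff ((1-x· f *ₜ P) n) k
      ≈⟨ T.distribʳ P 1ₜ (-ₜ (x· f)) n k ⟩
    coeff ((1ₜ *ₜ P +ₜ (-ₜ (x· f)) *ₜ P) n) k
      ≈⟨ coeff-+ ((1ₜ *ₜ P) n) _ k ⟩
    coeff ((1ₜ *ₜ P) n) k + coeff (((-ₜ (x· f)) *ₜ P) n) k
      ≈⟨ +-cong (T.*-identityˡ P n k) (sym (-‿distribˡ-*ₜ (x· f) P n k)) ⟩
    coeff (P n) k + coeff ((-ₜ ((x· f) *ₜ P)) n) k
      ≈⟨ +-congˡ (coeff-neg (((x· f) *ₜ P) n) k) ⟩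
    coeff (P n) k - coeff (((x· f) *ₜ P) n) k ∎
    where open Algebra.Properties.Ring T.ring using () renaming (-‿distribˡ-* to -‿distribˡ-*ₜ)

  -- In P - x f P the second term contributes nothing to column 0, which stays g, and cancels every
  -- later column by `column₁`.
  columns⇒fraction : ∀ {g f P} → HasColumns g f P → P *ₜ 1-x· f ≈ₜ embed g
  columns⇒fraction {g} {f} {P} (col₀ , col₁) n zero = begin
    coeff ((P *ₜ 1-x· f) n) 0
      ≈⟨ *-1-x· f P n 0 ⟩
    coeff (P n) 0 - coeff (((x· f) *ₜ P) n) 0
      ≈⟨ +-congˡ (-‿cong (x·-column₀ f P n)) ⟩
    coeff (P n) 0 - 0#
      ≈⟨ x-0≈x _ ⟩
    coeff (P n) 0
      ≈⟨ col₀ n ⟩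
    g n ∎
  columns⇒fraction {g} {f} {P} (col₀ , col₁) n (suc k) = trans
    (*-1-x· f P n (suc k))
    (x≈y⇒x-y≈0 (trans (col₁ k n) (sym (x·-column₁ f P n k))))

  columns⇒power : ∀ {g f P} → HasColumns g f P → ∀ k → column P k ≈ₛ g *ₛ (f ^ₛ k)
  columns⇒power {g} {f} {P} (col₀ , _) zero n = begin
    column P 0 n                ≈⟨ col₀ n ⟩
    g n                         ≈⟨ *ₛ-identityˡ g n ⟨
    ((f ^ₛ 0) *ₛ g) n           ≈⟨ *ₛ-comm (f ^ₛ 0) g n ⟩
    (g *ₛ (f ^ₛ 0)) n           ∎
  columns⇒power {g} {f} {P} cols@(_ , col₁) (suc k) n = begin
    column P (suc k) n
      ≈⟨ col₁ k n ⟩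
    (f *ₛ column P k) n
      ≈⟨ *ₛ-cong {f} (λ _ → refl) (columns⇒power cols k) n ⟩
    (f *ₛ (g *ₛ (f ^ₛ k))) n
      ≈⟨ x*yz≈y*xz f g (f ^ₛ k) n ⟩
    (g *ₛ (f ^ₛ suc k)) n ∎

  -- Consecutive columns g f^k and g f^(k+1) differ by a factor f. This puts the Riordan property
  -- into the form from which the converse starts.
  power⇒columns : ∀ {g f P} → (∀ k → column P k ≈ₛ g *ₛ (f ^ₛ k)) → HasColumns g f P
  power⇒columns {g} {f} {P} pow = col₀ , col₁
    where
    col₀ : column P 0 ≈ₛ g
    col₀ n = trans (pow 0 n)
      (trans (*ₛ-comm g (f ^ₛ 0) n) (*ₛ-identityˡ g n))
    col₁ : ∀ k → column P (suc k) ≈ₛ f *ₛ column P k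
    col₁ k n = begin
      column P (suc k) n
        ≈⟨ pow (suc k) n ⟩
      (g *ₛ (f ^ₛ suc k)) n
        ≈⟨ x*yz≈y*xz f g (f ^ₛ k) n ⟨
      (f *ₛ (g *ₛ (f ^ₛ k))) n
        ≈⟨ *ₛ-cong {f} (λ _ → refl) (pow k) n ⟨
      (f *ₛ column P k) n ∎

  -- From an affine recurrence to a Riordan array.

  module AffineRecurrence
    (a b : Poly) (p : ℕ → Poly)
    (rec : ∀ n → p (2 ℕ.+ n) ≈ₚ ((a *ₚ p (1 ℕ.+ n)) +ₚ (b *ₚ p n)))
    {a₀ a₁ b₀ b₁ c₀ d : Carrier}
    (cond : Conditions a b (p 0) (p 1) a₀ a₁ b₀ b₁ c₀ d)
    where
    open Conditions cond

    g f : Series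
    g = ⟦ c₀ ∷ d ∷ [] ⟧ *ₛ recip a₀ b₀
    f = ⟦ 0# ∷ a₁ ∷ b₁ ∷ [] ⟧ *ₛ recip a₀ b₀

    p₁-coeff : ∀ k → coeff (p 1) k - coeff (a *ₚ p 0) k ≈ coeff (d ∷ []) k
    p₁-coeff k = begin
      coeff (p 1) k - coeff (a *ₚ p 0) k
        ≈⟨ +-congˡ (coeff-neg (a *ₚ p 0) k) ⟨
      coeff (p 1) k + coeff (map -_ (a *ₚ p 0)) k
        ≈⟨ coeff-+ (p 1) _ k ⟨
      coeff (p 1 +ₚ map -_ (a *ₚ p 0)) k
        ≈⟨ d-constant k ⟩
      coeff (d ∷ []) k ∎

    -- Setting x = 0 in the recurrence leaves one with constant coefficients a₀ and b₀.
    column₀-numerator : column p 0 *ₛ denominator a₀ b₀ ≈ₛ ⟦ c₀ ∷ d ∷ [] ⟧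
    column₀-numerator zero =
      trans (*ₛ-denominator₀ a₀ b₀ (column p 0)) (p₀-constant 0)
    column₀-numerator (suc zero) = begin
      (column p 0 *ₛ denominator a₀ b₀) 1
        ≈⟨ *ₛ-denominator₁ a₀ b₀ (column p 0) ⟩
      coeff (p 1) 0 - a₀ * coeff (p 0) 0
        ≈⟨ +-congˡ (-‿cong (*-affine₀ a (p 0) a-affine)) ⟨
      coeff (p 1) 0 - coeff (a *ₚ p 0) 0
        ≈⟨ p₁-coeff 0 ⟩
      d ∎
    column₀-numerator (suc (suc n)) = trans
      (*ₛ-denominator₂ a₀ b₀ (column p 0) n)
      (x≈y⇒x-y≈0 (trans (rec n 0) (trans (coeff-+ (a *ₚ p (suc n)) _ 0)
        (+-cong (*-affine₀ a (p (suc n)) a-affine) (*-affine₀ b (p n) b-affine)))))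

    -- In the coefficient of x^(k+1), a₀ and b₀ act on column k + 1 and are absorbed by the
    -- denominator, while a₁ and b₁ act on column k and form the numerator of f.
    column₁-numerator : ∀ k → column p (suc k) *ₛ denominator a₀ b₀
                              ≈ₛ ⟦ 0# ∷ a₁ ∷ b₁ ∷ [] ⟧ *ₛ column p k
    column₁-numerator k zero = begin
      (column p (suc k) *ₛ denominator a₀ b₀) 0
        ≈⟨ *ₛ-denominator₀ a₀ b₀ (column p (suc k)) ⟩
      coeff (p 0) (suc k)
        ≈⟨ p₀-constant (suc k) ⟩
      0#
        ≈⟨ trans (+-identityʳ _) (zeroˡ _) ⟨
      0# * coeff (p 0) k + 0# ∎
    column₁-numerator k (suc zero) = begin
      (column p (suc k) *ₛ denominator a₀ b₀) 1
        ≈⟨ *ₛ-denominator₁ a₀ b₀ (column p (suc k)) ⟩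
      coeff (p 1) (suc k) - a₀ * coeff (p 0) (suc k)
        ≈⟨ +-cong p₁-value
             (trans (-‿cong (trans (*-congˡ (p₀-constant (suc k))) (zeroʳ _))) -0#≈0#) ⟩
      a₁ * coeff (p 0) k + 0#
        ≈⟨ trans (+-congʳ (zeroˡ _)) (+-identityˡ _) ⟨
      0# * coeff (p 1) k + (a₁ * coeff (p 0) k + 0#) ∎
      where
      -- In positive degree p₁ agrees with a p₀ by condition (3), and p₀ is constant by (2).
      p₁-value : coeff (p 1) (suc k) ≈ a₁ * coeff (p 0) k
      p₁-value = begin
        coeff (p 1) (suc k)
          ≈⟨ x-y≈0⇒x≈y _ _ (p₁-coeff (suc k)) ⟩
        coeff (a *ₚ p 0) (suc k)
          ≈⟨ *-affine₁ a (p 0) k a-affine ⟩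
        a₀ * coeff (p 0) (suc k) + a₁ * coeff (p 0) k
          ≈⟨ +-congʳ (trans (*-congˡ (p₀-constant (suc k))) (zeroʳ _)) ⟩
        0# + a₁ * coeff (p 0) k
          ≈⟨ +-identityˡ _ ⟩
        a₁ * coeff (p 0) k ∎
    column₁-numerator k (suc (suc n)) = begin
      (column p (suc k) *ₛ denominator a₀ b₀) (2 ℕ.+ n)
        ≈⟨ *ₛ-denominator₂ a₀ b₀ (column p (suc k)) n ⟩
      coeff (p (2 ℕ.+ n)) (suc k) - old
        ≈⟨ +-congʳ (trans (rec n (suc k)) (trans (coeff-+ (a *ₚ p (suc n)) _ (suc k))
             (+-cong (*-affine₁ a (p (suc n)) k a-affine)
                     (*-affine₁ b (p n) k b-affine)))) ⟩
      (a₀ * coeff (p (suc n)) (suc k) + a₁ * coeff (p (suc n)) k)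
        + (b₀ * coeff (p n) (suc k) + b₁ * coeff (p n) k) - old
        -- The terms are sorted by column: `old` comes from column k + 1, `new` from column k.
        ≈⟨ +-congʳ (interchange _ _ _ _) ⟩
      old + new - old
        ≈⟨ xyx⁻¹≈y old new ⟩
      new
        ≈⟨ *ₛ-linear a₁ b₁ (column p k) n ⟨
      (⟦ a₁ ∷ b₁ ∷ [] ⟧ *ₛ column p k) (suc n)
        ≈⟨ trans (+-congʳ (zeroˡ _)) (+-identityˡ _) ⟨
      (⟦ 0# ∷ a₁ ∷ b₁ ∷ [] ⟧ *ₛ column p k) (2 ℕ.+ n) ∎
      where
      old = a₀ * coeff (p (suc n)) (suc k) + b₀ * coeff (p n) (suc k)
      new = a₁ * coeff (p (suc n)) k + b₁ * coeff (p n) k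

    columns : HasColumns g f p
    columns = record
      { column₀ = *ₛ-recip a₀ b₀ (column p 0) _ column₀-numerator
      ; column₁ = λ k n → trans
          (*ₛ-recip a₀ b₀ (column p (suc k)) _ (column₁-numerator k) n)
          (xy*z≈xz*y ⟦ 0# ∷ a₁ ∷ b₁ ∷ [] ⟧ (column p k) (recip a₀ b₀) n)
      }

    g₀≈c₀ : g 0 ≈ c₀
    g₀≈c₀ = trans (+-identityʳ _) (*-identityʳ c₀)

    f₀≈0 : f 0 ≈ 0#
    f₀≈0 = trans (+-identityʳ _) (zeroˡ _)

    f₁≈a₁ : f 1 ≈ a₁
    f₁≈a₁ = trans (+-cong (zeroˡ _) (+-identityʳ _))
      (trans (+-identityˡ _) (*-identityʳ a₁))

    isRiordan : c₀ # 0# → a₁ # 0# → IsRiordan (λ n k → coeff (p n) k)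
    isRiordan c₀#0 a₁#0 = record
      { g    = g
      ; f    = f
      ; g₀≠0 = #-congʳ (sym g₀≈c₀) c₀#0
      ; f₀≈0 = f₀≈0
      ; f₁≠0 = #-congʳ (sym f₁≈a₁) a₁#0
      } , λ n k → columns⇒power columns k n

  -- From a Riordan array to an affine recurrence.

  module RiordanRecurrence
    (a b : Poly) (p : ℕ → Poly)
    (rec : ∀ n → p (2 ℕ.+ n) ≈ₚ ((a *ₚ p (1 ℕ.+ n)) +ₚ (b *ₚ p n)))
    (g f : Series) (g₀#0 : g 0 # 0#) (f₀≈0 : f 0 ≈ 0#) (f₁#0 : f 1 # 0#)
    (columns : HasColumns g f p)
    where
    open HasColumns columns

    q : Poly
    q = p 1 +ₚ map -_ (a *ₚ p 0)

    numerator : Seriesₜ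
    numerator = 𝕂[x]⟦t⟧.⟦ p 0 ∷ q ∷ [] ⟧

    -- Multiplying P by 1 - x f and by 1 - a t - b t² in either order eliminates P without a
    -- division.
    cross-multiplied : embed g *ₜ TP.denominator a b ≈ₜ numerator *ₜ 1-x· f
    cross-multiplied n k = begin
      coeff ((embed g *ₜ V) n) k
        ≈⟨ TP.*ₛ-cong {p *ₜ 1-x· f} {embed g} {V} {V}
             (columns⇒fraction columns) (λ _ _ → refl) n k ⟨
      coeff (((p *ₜ 1-x· f) *ₜ V) n) k
        ≈⟨ xy*z≈xz*yₜ p (1-x· f) V n k ⟩
      coeff (((p *ₜ V) *ₜ 1-x· f) n) k
        ≈⟨ TP.*ₛ-cong {p *ₜ V} {numerator} {1-x· f} {1-x· f}
             (TP.recurrence⇒numerator a b p rec) (λ _ _ → refl) n k ⟩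
      coeff ((numerator *ₜ 1-x· f) n) k ∎
      where
      V = TP.denominator a b
      open Algebra.Properties.CommutativeSemigroup T.*-commutativeSemigroup
        using () renaming (xy∙z≈xz∙y to xy*z≈xz*yₜ)

    -- As f₀ = 0, the first term of the convolution drops out, and row n + 1 depends only on rows 0
    -- to n.
    entry : ∀ n k → coeff (p (suc n)) (suc k) ≈ (tail f *ₛ column p k) n
    entry n k = trans (column₁ k (suc n))
      (trans (+-congʳ (trans (*-congʳ f₀≈0) (zeroˡ _))) (+-identityˡ _))

    p₀-constant : p 0 ≈ₚ (g 0 ∷ [])
    p₀-constant zero    = column₀ 0
    p₀-constant (suc k) = trans (column₁ k 0)
      (trans (+-identityʳ _) (trans (*-congʳ f₀≈0) (zeroˡ _)))

    p₁-value : p 1 ≈ₚ (g 1 ∷ f 1 * g 0 ∷ [])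
    p₁-value zero          = column₀ 1
    p₁-value (suc zero)    = trans (entry 0 0)
      (trans (+-identityʳ _) (*-congˡ (p₀-constant 0)))
    p₁-value (suc (suc k)) = trans (entry 0 (suc k))
      (trans (+-identityʳ _) (trans (*-congˡ (p₀-constant (suc k))) (zeroʳ _)))

    -- With `p₀-constant` and `p₁-value`, this makes p₀ p₂ and p₁² explicit for the comparison in
    -- `geometric`.
    p₂-value : p 2 ≈ₚ (g 2 ∷ f 1 * g 1 + f 2 * g 0 ∷ f 1 * (f 1 * g 0) ∷ [])
    p₂-value zero    = column₀ 2
    p₂-value (suc k) = trans (entry 1 k)
      (trans (+-cong (*-congˡ (p₁-value k))
                     (trans (+-identityʳ _) (*-congˡ (p₀-constant k))))
             (value k))
      where
      value : ∀ k → f 1 * coeff (g 1 ∷ f 1 * g 0 ∷ []) k + f 2 * coeff (g 0 ∷ []) k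
                    ≈ coeff (f 1 * g 1 + f 2 * g 0 ∷ f 1 * (f 1 * g 0) ∷ []) k
      value zero          = refl
      value (suc zero)    = trans (+-congˡ (zeroʳ _)) (+-identityʳ _)
      value (suc (suc k)) = trans (+-cong (zeroʳ _) (zeroʳ _)) (+-identityʳ _)

    -- This is the coefficient of t x^(k+1) in the cross-multiplied identity, obtained directly from
    -- the definition of q and row 1.
    coefficients₁ : ∀ k → coeff a (suc k) * g 0 + coeff q (suc k)
                          ≈ coeff (p 0) k * f 1
    coefficients₁ k = begin
      x + coeff q (suc k)
        ≈⟨ +-congˡ (coeff-+ (p 1) _ (suc k)) ⟩
      x + (coeff (p 1) (suc k) + coeff (map -_ (a *ₚ p 0)) (suc k))
        ≈⟨ +-congˡ (+-congˡ (trans (coeff-neg (a *ₚ p 0) (suc k))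
             (-‿cong (*-constantʳ a (p 0) p₀-constant (suc k))))) ⟩
      x + (coeff (p 1) (suc k) - x)
        ≈⟨ +-assoc _ _ _ ⟨
      x + coeff (p 1) (suc k) - x
        ≈⟨ xyx⁻¹≈y x _ ⟩
      coeff (p 1) (suc k)
        ≈⟨ entry 0 k ⟩
      f 1 * coeff (p 0) k + 0#
        ≈⟨ trans (+-identityʳ _) (*-comm _ _) ⟩
      coeff (p 0) k * f 1 ∎
      where x = coeff a (suc k) * g 0

    -- Here the coefficients of t^(n+2) x^(k+1) are compared, with both sides negated.
    coefficients₂ : ∀ n k →
      coeff a (suc k) * g (1 ℕ.+ n) + coeff b (suc k) * g n
        ≈ coeff (p 0) k * f (2 ℕ.+ n) + coeff q k * f (1 ℕ.+ n)
    coefficients₂ n k = -‿injective (begin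
      - (coeff a (suc k) * g (1 ℕ.+ n) + coeff b (suc k) * g n)
        ≈⟨ -‿cong (+-cong (*-constantʳ a (embed g (1 ℕ.+ n)) (λ _ → refl) (suc k))
                          (*-constantʳ b (embed g n) (λ _ → refl) (suc k))) ⟨
      - (coeff (a *ₚ embed g (1 ℕ.+ n)) (suc k) + coeff (b *ₚ embed g n) (suc k))
        ≈⟨ -‿cong (coeff-+ (a *ₚ embed g (1 ℕ.+ n)) _ (suc k)) ⟨
      - coeff u (suc k)
        ≈⟨ coeff-neg u (suc k) ⟨
      coeff (map -_ u) (suc k)
        ≈⟨ trans (coeff-+ (embed g (2 ℕ.+ n)) (map -_ u) (suc k)) (+-identityˡ _) ⟨
      coeff (embed g (2 ℕ.+ n) +ₚ map -_ u) (suc k)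
        ≈⟨ TP.*ₛ-denominator₂ a b (embed g) n (suc k) ⟨
      coeff ((embed g *ₜ TP.denominator a b) (2 ℕ.+ n)) (suc k)
        ≈⟨ cross-multiplied (2 ℕ.+ n) (suc k) ⟩
      coeff ((numerator *ₜ 1-x· f) (2 ℕ.+ n)) (suc k)
        ≈⟨ *-1-x· f numerator (2 ℕ.+ n) (suc k) ⟩
      -- The numerator has degree at most 1 in t, so only its product with x f contributes.
      0# - coeff (((x· f) *ₜ numerator) (2 ℕ.+ n)) (suc k)
        ≈⟨ +-identityˡ _ ⟩
      - coeff (((x· f) *ₜ numerator) (2 ℕ.+ n)) (suc k)
        ≈⟨ -‿cong (x·-column₁ f numerator (2 ℕ.+ n) k) ⟩
      - (f *ₛ column numerator k) (2 ℕ.+ n)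
        ≈⟨ -‿cong (*ₛ-comm f (column numerator k) (2 ℕ.+ n)) ⟩
      - (column numerator k *ₛ f) (2 ℕ.+ n)
        ≈⟨ -‿cong (*ₛ-cong {u = f} numerator-column (λ _ → refl) (2 ℕ.+ n)) ⟩
      - (⟦ coeff (p 0) k ∷ coeff q k ∷ [] ⟧ *ₛ f) (2 ℕ.+ n)
        ≈⟨ -‿cong (*ₛ-linear (coeff (p 0) k) (coeff q k) f (1 ℕ.+ n)) ⟩
      - (coeff (p 0) k * f (2 ℕ.+ n) + coeff q k * f (1 ℕ.+ n)) ∎)
      where
      u = (a *ₚ embed g (1 ℕ.+ n)) +ₚ (b *ₚ embed g n)
      numerator-column : column numerator k ≈ₛ ⟦ coeff (p 0) k ∷ coeff q k ∷ [] ⟧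
      numerator-column zero          = refl
      numerator-column (suc zero)    = refl
      numerator-column (suc (suc i)) = refl

    a-vanishes : ∀ k → coeff q (2 ℕ.+ k) ≈ 0# → coeff a (2 ℕ.+ k) ≈ 0#
    a-vanishes k q≈0 = #0-cancelˡ-0 _ g₀#0 (begin
      g 0 * coeff a (2 ℕ.+ k)
        ≈⟨ *-comm _ _ ⟩
      coeff a (2 ℕ.+ k) * g 0
        ≈⟨ trans (+-congˡ q≈0) (+-identityʳ _) ⟨
      coeff a (2 ℕ.+ k) * g 0 + coeff q (2 ℕ.+ k)
        ≈⟨ coefficients₁ (suc k) ⟩
      coeff (p 0) (suc k) * f 1
        ≈⟨ trans (*-congʳ (p₀-constant (suc k))) (zeroˡ _) ⟩
      0# ∎)

    -- In `coefficients₂` at x^(k+2) the terms of a and p₀ vanish. Taken over all n, what is left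
    -- relates t g and f by constant factors.
    b-multiple : ∀ k n → coeff q (2 ℕ.+ k) ≈ 0# →
                 coeff b (2 ℕ.+ k) * g n ≈ coeff q (1 ℕ.+ k) * f (1 ℕ.+ n)
    b-multiple k n q≈0 = begin
      coeff b (2 ℕ.+ k) * g n
        ≈⟨ trans (+-congʳ (trans (*-congʳ (a-vanishes k q≈0)) (zeroˡ _)))
             (+-identityˡ _) ⟨
      coeff a (2 ℕ.+ k) * g (1 ℕ.+ n) + coeff b (2 ℕ.+ k) * g n
        ≈⟨ coefficients₂ n (suc k) ⟩
      coeff (p 0) (suc k) * f (2 ℕ.+ n) + coeff q (suc k) * f (1 ℕ.+ n)
        ≈⟨ trans (+-congʳ (trans (*-congʳ (p₀-constant (suc k))) (zeroˡ _)))
             (+-identityˡ _) ⟩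
      coeff q (1 ℕ.+ k) * f (1 ℕ.+ n) ∎

    -- Here m = k + 1 is the degree of q.
    module _ (k : ℕ) (qₘ#0 : coeff q (1 ℕ.+ k) # 0#)
             (qₘ₊₁≈0 : coeff q (2 ℕ.+ k) ≈ 0#) where
      α  = coeff a (1 ℕ.+ k)
      β  = coeff b (1 ℕ.+ k)
      β′ = coeff b (2 ℕ.+ k)
      ρ  = coeff q (1 ℕ.+ k)
      σ  = coeff q k
      π  = coeff (p 0) k

      -- Once ρ can be cancelled, f is a multiple of t g. Evaluating β′ g₀ g₁ in two ways eliminates
      -- the factor.
      f∝tg : f 1 * g 1 ≈ f 2 * g 0
      f∝tg = #0-cancelˡ _ _ qₘ#0 (begin
        ρ * (f 1 * g 1)   ≈⟨ *-assoc _ _ _ ⟨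
        ρ * f 1 * g 1     ≈⟨ *-congʳ (b-multiple k 0 qₘ₊₁≈0) ⟨
        β′ * g 0 * g 1    ≈⟨ xy∙z≈xz∙y _ _ _ ⟩
        β′ * g 1 * g 0    ≈⟨ *-congʳ (b-multiple k 1 qₘ₊₁≈0) ⟩
        ρ * f 2 * g 0     ≈⟨ *-assoc _ _ _ ⟩
        ρ * (f 2 * g 0)   ∎)

      -- Multiply `coefficients₂` by ρ g₀ and use `b-multiple` to replace f by g. What remains makes
      -- g (n+1) a fixed multiple of g n. Keeping π unevaluated treats k = 0 and k > 0 alike.
      g-ratio : ∀ n → ρ * β * g 0 * g n ≈ ρ * ρ * g (1 ℕ.+ n) + σ * β′ * g 0 * g n
      g-ratio n = +-cancelˡ (α * ρ * g 0 * g (1 ℕ.+ n)) _ _ (begin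
        α * ρ * g 0 * g (1 ℕ.+ n) + ρ * β * g 0 * g n
          ≈⟨ solve 6 (λ a r g₀ g₁ b g → a :* r :* g₀ :* g₁ :+ r :* b :* g₀ :* g
                        := r :* g₀ :* (a :* g₁ :+ b :* g)) refl _ _ _ _ _ _ ⟩
        ρ * g 0 * (α * g (1 ℕ.+ n) + β * g n)
          ≈⟨ *-congˡ (coefficients₂ n k) ⟩
        ρ * g 0 * (π * f (2 ℕ.+ n) + σ * f (1 ℕ.+ n))
          ≈⟨ solve 6 (λ r g₀ p f₂ s f₁ → r :* g₀ :* (p :* f₂ :+ s :* f₁)
                        := g₀ :* (p :* (r :* f₂) :+ s :* (r :* f₁))) refl _ _ _ _ _ _ ⟩
        g 0 * (π * (ρ * f (2 ℕ.+ n)) + σ * (ρ * f (1 ℕ.+ n)))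
          ≈⟨ *-congˡ (+-cong (*-congˡ (b-multiple k (1 ℕ.+ n) qₘ₊₁≈0))
                             (*-congˡ (b-multiple k n qₘ₊₁≈0))) ⟨
        g 0 * (π * (β′ * g (1 ℕ.+ n)) + σ * (β′ * g n))
          ≈⟨ solve 6 (λ g₀ p b g₁ s g → g₀ :* (p :* (b :* g₁) :+ s :* (b :* g))
                        := p :* (b :* g₀) :* g₁ :+ s :* b :* g₀ :* g)
               refl _ _ _ _ _ _ ⟩
        π * (β′ * g 0) * g (1 ℕ.+ n) + σ * β′ * g 0 * g n
          ≈⟨ +-congʳ (*-congʳ (*-congˡ (b-multiple k 0 qₘ₊₁≈0))) ⟩
        π * (ρ * f 1) * g (1 ℕ.+ n) + σ * β′ * g 0 * g n
          ≈⟨ +-congʳ (*-congʳ (x∙yz≈y∙xz _ _ _)) ⟩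
        ρ * (π * f 1) * g (1 ℕ.+ n) + σ * β′ * g 0 * g n
          -- Replacing π f₁ by α g₀ + ρ produces the α term that is cancelled.
          ≈⟨ +-congʳ (*-congʳ (*-congˡ (coefficients₁ k))) ⟨
        ρ * (α * g 0 + ρ) * g (1 ℕ.+ n) + σ * β′ * g 0 * g n
          ≈⟨ solve 5 (λ r a g₀ g₁ x → r :* (a :* g₀ :+ r) :* g₁ :+ x
                        := a :* r :* g₀ :* g₁ :+ (r :* r :* g₁ :+ x))
               refl _ _ _ _ _ ⟩
        α * ρ * g 0 * g (1 ℕ.+ n) + (ρ * ρ * g (1 ℕ.+ n) + σ * β′ * g 0 * g n) ∎)

      -- The cases n = 0 and n = 1 of `g-ratio`, multiplied by g₁ and g₀, have the same left side.
      -- Their σ terms cancel, and then ρ².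
      g-geometric : g 1 * g 1 ≈ g 0 * g 2
      g-geometric = #0-cancelˡ _ _ qₘ#0 (#0-cancelˡ _ _ qₘ#0
        (+-cancelʳ (σ * β′ * g 0 * g 0 * g 1) _ _ (begin
          ρ * (ρ * (g 1 * g 1)) + σ * β′ * g 0 * g 0 * g 1
            ≈⟨ solve 3 (λ r g x → r :* (r :* (g :* g)) :+ x :* g
                          := (r :* r :* g :+ x) :* g) refl _ _ _ ⟩
          (ρ * ρ * g 1 + σ * β′ * g 0 * g 0) * g 1
            ≈⟨ *-congʳ (g-ratio 0) ⟨
          ρ * β * g 0 * g 0 * g 1
            ≈⟨ xy∙z≈xz∙y _ _ _ ⟩
          ρ * β * g 0 * g 1 * g 0
            ≈⟨ *-congʳ (g-ratio 1) ⟩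
          (ρ * ρ * g 2 + σ * β′ * g 0 * g 1) * g 0
            ≈⟨ solve 5 (λ r g₀ g₁ g₂ x → (r :* r :* g₂ :+ x :* g₀ :* g₁) :* g₀
                          := r :* (r :* (g₀ :* g₂)) :+ x :* g₀ :* g₀ :* g₁)
                 refl _ _ _ _ _ ⟩
          ρ * (ρ * (g 0 * g 2)) + σ * β′ * g 0 * g 0 * g 1 ∎)))

      -- The constant terms agree by `g-geometric`, the coefficients of x by `f∝tg`, and those of x²
      -- identically.
      geometric : (p 0 *ₚ p 2) ≈ₚ (p 1 *ₚ p 1)
      geometric n = trans (P.*-cong {p 0} {u} {p 2} {w} p₀-constant p₂-value n)
        (trans (product n) (sym (P.*-cong {p 1} {v} {p 1} {v} p₁-value p₁-value n)))
        where
        module P = CommutativeRing 𝕂[x]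
        u v w : Poly
        u = g 0 ∷ []
        v = g 1 ∷ f 1 * g 0 ∷ []
        w = g 2 ∷ f 1 * g 1 + f 2 * g 0 ∷ f 1 * (f 1 * g 0) ∷ []

        product : (u *ₚ w) ≈ₚ (v *ₚ v)
        product zero                = +-congʳ (sym g-geometric)
        product (suc zero)          = begin
          g 0 * (f 1 * g 1 + f 2 * g 0)
            ≈⟨ *-congˡ (+-congˡ f∝tg) ⟨
          g 0 * (f 1 * g 1 + f 1 * g 1)
            ≈⟨ solve 3 (λ f g₀ g₁ → g₀ :* (f :* g₁ :+ f :* g₁)
                          := g₁ :* (f :* g₀) :+ (f :* g₀ :* g₁ :+ con 0)) refl _ _ _ ⟩
          g 1 * (f 1 * g 0) + (f 1 * g 0 * g 1 + 0#) ∎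
        product (suc (suc zero))    =
          solve 2 (λ f g → g :* (f :* (f :* g)) := f :* g :* (f :* g)) refl _ _
        product (suc (suc (suc n))) = refl

    module _ (nongeometric : ¬ ((p 0 *ₚ p 2) ≈ₚ (p 1 *ₚ p 1))) where

      q-vanishes : ∀ k → coeff q (1 ℕ.+ k) ≈ 0#
      q-vanishes = vanish-downwards q 1 λ k qₘ₊₁≈0 →
        -- A coefficient apart from zero, with the next one zero, would make the sequence geometric.
        proj₁ (tight _ _) λ qₘ#0 → nongeometric (geometric k qₘ#0 qₘ₊₁≈0)

      b-vanishes : ∀ k → coeff b (2 ℕ.+ k) ≈ 0#
      b-vanishes k = #0-cancelˡ-0 _ g₀#0 (trans (*-comm _ _)
        (trans (b-multiple k 0 (q-vanishes (suc k)))
               (trans (*-congʳ (q-vanishes k)) (zeroˡ _))))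

      -- This transfers f₁ # 0 to the coefficient a₁ in the conclusion.
      a₁≈f₁ : coeff a 1 ≈ f 1
      a₁≈f₁ = #0-cancelˡ _ _ g₀#0 (begin
        g 0 * coeff a 1               ≈⟨ *-comm _ _ ⟩
        coeff a 1 * g 0               ≈⟨ trans (+-congˡ (q-vanishes 0)) (+-identityʳ _) ⟨
        coeff a 1 * g 0 + coeff q 1   ≈⟨ coefficients₁ 0 ⟩
        coeff (p 0) 0 * f 1           ≈⟨ *-congʳ (p₀-constant 0) ⟩
        g 0 * f 1                     ∎)

      conditions : ∃[ a₀ ] ∃[ a₁ ] ∃[ b₀ ] ∃[ b₁ ] ∃[ c₀ ] ∃[ d ]
        (Conditions a b (p 0) (p 1) a₀ a₁ b₀ b₁ c₀ d × c₀ # 0# × a₁ # 0#)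
      conditions =
        coeff a 0 , coeff a 1 , coeff b 0 , coeff b 1 , g 0 , coeff q 0 , record
          { a-affine    = affine a λ k → a-vanishes k (q-vanishes (suc k))
          ; b-affine    = affine b b-vanishes
          ; p₀-constant = p₀-constant
          ; d-constant  = λ { zero → refl ; (suc k) → q-vanishes k }
          } , g₀#0 , #-congʳ (sym a₁≈f₁) f₁#0
        where
        affine : ∀ r → (∀ k → coeff r (2 ℕ.+ k) ≈ 0#) →
                 r ≈ₚ (coeff r 0 ∷ coeff r 1 ∷ [])
        affine r r≈0 zero          = refl
        affine r r≈0 (suc zero)    = refl
        affine r r≈0 (suc (suc k)) = r≈0 k

  -- With f₀ = 0 the constant term in t of 1 - x f is the polynomial 1, which is its own inverse.
  invertible-1-x· : ∀ f → f 0 ≈ 0# →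
    Invertible _≈ₚ_ (1# ∷ []) _*ₚ_ (1-x· f 0)
  invertible-1-x· f f₀≈0 =
    (1# ∷ []) , (λ k → trans (P.*-identityˡ (1-x· f 0) k) (≈1 k))
              , (λ k → trans (P.*-identityʳ (1-x· f 0) k) (≈1 k))
    where
    module P = CommutativeRing 𝕂[x]
    ≈1 : 1-x· f 0 ≈ₚ (1# ∷ [])
    ≈1 zero          = x-0≈x 1#
    ≈1 (suc zero)    = trans (-‿cong f₀≈0) -0#≈0#
    ≈1 (suc (suc k)) = refl

theorem2p1 :
    ∀ {c ℓ₁ ℓ₂} (K : HeytingField c ℓ₁ ℓ₂) → CharacteristicZero K →
    let open Riordan K in
    (a b : Poly) (p : ℕ → Poly) → SatisfiesRecurrence a b p →
    let P = generatingFunction p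
        q = p 1 + - (a * p 0)
        Cond = Conditions a b (p 0) (p 1)
    in
    -- P = (p₀ + (p₁ - a p₀) t) / (1 - a t - b t²)
    (P K[x]⟦t⟧.≈ K[x]⟦t⟧.⟦ p 0 ∷ q ∷ [] ⟧ / K[x]⟦t⟧.⟦ 1ₚ ∷ - a ∷ - b ∷ [] ⟧)
    -- Riordan implies (1)-(3), for a sequence that is not geometric: a geometric
    -- one, such as pₙ = (1 + x)ⁿ, has recurrences violating (1) and (3)
    × (p 0 * p 2 ≉ p 1 * p 1 → IsRiordan (coefficientMatrix p) →
        ∃[ a₀ ] ∃[ a₁ ] ∃[ b₀ ] ∃[ b₁ ] ∃[ c₀ ] ∃[ d ]
          (Cond a₀ a₁ b₀ b₁ c₀ d × c₀ # 0# × a₁ # 0#))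
    -- (1)-(3) imply Riordan, where g₀ = c₀ and f₁ = a₁ have to be nonzero
    × (∀ a₀ a₁ b₀ b₁ c₀ d → Cond a₀ a₁ b₀ b₁ c₀ d → c₀ # 0# → a₁ # 0# →
        IsRiordan (coefficientMatrix p))
    -- P = g / (1 - x f)
    × (∀ a₀ a₁ b₀ b₁ c₀ d → Cond a₀ a₁ b₀ b₁ c₀ d →
        ∃[ g ] ∃[ f ]
          ( (g K⟦t⟧.≈ K⟦t⟧.⟦ c₀ ∷ d ∷ [] ⟧ / K⟦t⟧.⟦ 1# ∷ -ₖ a₀ ∷ -ₖ b₀ ∷ [] ⟧)
          × (f K⟦t⟧.≈ K⟦t⟧.⟦ 0# ∷ a₁ ∷ b₁ ∷ [] ⟧ / K⟦t⟧.⟦ 1# ∷ -ₖ a₀ ∷ -ₖ b₀ ∷ [] ⟧)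
          × (P K[x]⟦t⟧.≈ embed g / (K[x]⟦t⟧.1# K[x]⟦t⟧.+ (K[x]⟦t⟧.- (x· f))))))
theorem2p1 K _ a b p rec = fraction , necessary , sufficient , closed-form
  where
  open RiordanProperties K
  open SeriesProperties 𝕂 using (recip-quotient)

  fraction = invertible-1 𝕂[x] , TP.recurrence⇒numerator a b p rec

  necessary = λ nongeometric (A , p≈A) →
    let module A = Riordan.RiordanArray A
    in RiordanRecurrence.conditions a b p rec A.g A.f A.g₀≠0 A.f₀≈0 A.f₁≠0
         -- Entry (n, k) of the matrix is the coefficient of t^n in column k, hence the exchange of
         -- indices.
         (power⇒columns λ k n → p≈A n k) nongeometric

  sufficient = λ a₀ a₁ b₀ b₁ c₀ d cond →
    AffineRecurrence.isRiordan a b p rec cond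

  closed-form = λ a₀ a₁ b₀ b₁ c₀ d cond →
    let open AffineRecurrence a b p rec cond
    in g , f
       , (invertible-1 𝕂 , recip-quotient a₀ b₀ _)
       , (invertible-1 𝕂 , recip-quotient a₀ b₀ _)
       , (invertible-1-x· f f₀≈0 , columns⇒fraction columns)
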